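{- Let $a$ be a positive integer, let $k=2^a-1$, let $V$ be a set of size $2k$, and let $D\subseteq\binom{V}{k}$ be a design with the parameters $(k-1)$-$(2k,k,2^{a-1})$. Then $D$ is anti-complementary, meaning that for all $K\in\binom{V}{k}$, we have $K\in D\iff V\setminus K\notin D$.
   Context: $\binom{V}{k}$ is the set of all $k$-element subsets of $V$. For a set $V$ of size $v$, a set $D\subseteq\binom{V}{k}$ is called a $t$-$(v,k,\lambda)$ design if for every $t$-element subset $T$ of $V$ there are exactly $\lambda$ elements of $D$ containing $T$. -}

module Defs where

open import Data.Fin.Subset using (Subset; ∣_∣; ∁)
open import Data.Fin.Subset.Properties using (_⊆?_)
open import Data.List using (List; length; filter)
open import Data.List.Membership.Propositional using (_∈_; _∉_)
open import Data.List.Relation.Unary.Unique.Propositional using (Unique)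
open import Data.Nat using (ℕ)
open import Function.Bundles using (_⇔_)
open import Relation.Binary.PropositionalEquality using (_≡_)

-- The v-element set V is Fin v.  A finite set D of subsets of V is given by a
-- list of its elements; `distinct` below makes it a set rather than a multiset,
-- so that lengths of filtered lists are cardinalities.

record IsDesign (t v k μ : ℕ) (D : List (Subset v)) : Set where
  field
    distinct  : Unique D
    blockSize : ∀ {K} → K ∈ D → ∣ K ∣ ≡ k
    balanced  : ∀ (T : Subset v) → ∣ T ∣ ≡ t → length (filter (T ⊆?_) D) ≡ μ

AntiComplementary : (v k : ℕ) → List (Subset v) → Set
AntiComplementary v k D = ∀ (K : Subset v) → ∣ K ∣ ≡ k → K ∈ D ⇔ ∁ K ∉ D

{-# OPTIONS --safe #-}

-- Give each block of D weight 2 and each k-subset of V an additional weight −1,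
-- and let h S be the total weight of the k-subsets containing S.  The design
-- condition says h T = 0 for |T| = k − 1.  Since Σ_{x ∉ S} h (S ∪ x) =
-- (k − |S|) h S, descending induction gives h S = 0 for every |S| < k.
-- Inclusion–exclusion over the subsets of a k-set K then leaves the single term
-- (−1)^k h K, and what it computes is the weight of the k-sets disjoint from K,
-- i.e. h (∁ K).  As k is odd, h (∁ K) = − h K, while h is 1 on blocks and −1 on
-- the other k-sets.
module Submission where

open import Data.Bool using (true; false; if_then_else_)
open import Data.Fin.Subset using (Subset; ∣_∣; ∁; _⊆_; inside; outside)
open import Data.Fin.Subset.Properties
  using (_⊆?_; ⊆-reflexive; p⊆q⇒∣p∣≤∣q∣; drop-∷-⊆; ∣∁p∣≡n∸∣p∣)
open import Data.Integer as ℤ using (ℤ; +_; 0ℤ; 1ℤ; -1ℤ; _+_; _-_)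
import Data.Integer.Properties as ℤₚ
open import Data.Integer.Tactic.RingSolver using (solve-∀)
open import Data.List using (List; []; _∷_; _++_; length; filter; map)
open import Data.List.Membership.Propositional using (_∈_; _∉_)
open import Data.List.Membership.Propositional.Properties using (∈-filter⁻)
open import Data.List.Properties using (filter-some)
import Data.List.Relation.Unary.All as All
open import Data.List.Relation.Unary.All using (All; []; _∷_)
open import Data.List.Relation.Unary.All.Properties using (map⁺; ++⁺)
import Data.List.Relation.Unary.Any as Any
open import Data.Nat as ℕ using (ℕ; zero; suc; _*_; _∸_; _^_; _≤_; _<_; z≤n; s≤s)
import Data.Nat.Properties as ℕₚ
open import Data.Product using (_×_; _,_; map₂)
open import Data.Vec using ([]; _∷_; here)
open import Function using (_∘_)
open import Function.Bundles using (mk⇔)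
open import Relation.Binary.PropositionalEquality
  using (_≡_; refl; sym; trans; cong; cong₂; subst; module ≡-Reasoning)
open import Relation.Nullary using (does; contradiction)
open import Relation.Nullary.Decidable using (does-⇔; dec-false)
open import Defs

-- Integer-weighted families of subsets

private
  variable
    n k : ℕ

-- A subset may occur several times, its weights then adding up, so two families are superposed by
-- plain concatenation.
WeightedFamily : ℕ → Set
WeightedFamily n = List (ℤ × Subset n)

Uniform : ℕ → WeightedFamily n → Set
Uniform k = All (λ (_ , L) → ∣ L ∣ ≡ k)

∫ : WeightedFamily n → (Subset n → ℤ) → ℤ
∫ []            g = 0ℤ
∫ ((w , L) ∷ W) g = w ℤ.* g L + ∫ W g

𝟙[_⊆_] : Subset n → Subset n → ℤ
𝟙[ S ⊆ L ] = if does (S ⊆? L) then 1ℤ else 0ℤ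

weightAbove : WeightedFamily n → Subset n → ℤ
weightAbove W S = ∫ W (𝟙[ S ⊆_])

∫-cong : ∀ {W : WeightedFamily n} {f g} →
  All (λ (_ , L) → f L ≡ g L) W → ∫ W f ≡ ∫ W g
∫-cong             []       = refl
∫-cong {W = (w , _) ∷ _} (eq ∷ eqs) = cong₂ _+_ (cong (w ℤ.*_) eq) (∫-cong eqs)

∫-+ : ∀ (W : WeightedFamily n) f g → ∫ W (λ L → f L + g L) ≡ ∫ W f + ∫ W g
∫-+ []            f g = refl
∫-+ ((w , L) ∷ W) f g rewrite ∫-+ W f g =
  distribute w (f L) (g L) (∫ W f) (∫ W g)
  where
  distribute : ∀ w a b c d → w ℤ.* (a + b) + (c + d) ≡ (w ℤ.* a + c) + (w ℤ.* b + d)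
  distribute = solve-∀

∫-* : ∀ (W : WeightedFamily n) c f → ∫ W (λ L → c ℤ.* f L) ≡ c ℤ.* ∫ W f
∫-* []            c f = sym (ℤₚ.*-zeroʳ c)
∫-* ((w , L) ∷ W) c f rewrite ∫-* W c f = pull-out w c (f L) (∫ W f)
  where
  pull-out : ∀ w c a b → w ℤ.* (c ℤ.* a) + c ℤ.* b ≡ c ℤ.* (w ℤ.* a + b)
  pull-out = solve-∀

∫-0 : ∀ (W : WeightedFamily n) → ∫ W (λ _ → 0ℤ) ≡ 0ℤ
∫-0 W = ∫-* W 0ℤ (λ _ → 0ℤ)

∫-++ : ∀ (W W′ : WeightedFamily n) g → ∫ (W ++ W′) g ≡ ∫ W g + ∫ W′ g
∫-++ []            W′ g = sym (ℤₚ.+-identityˡ _)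
∫-++ ((w , L) ∷ W) W′ g rewrite ∫-++ W W′ g =
  sym (ℤₚ.+-assoc (w ℤ.* g L) (∫ W g) (∫ W′ g))

∫-map : ∀ {m} (f : Subset m → Subset n) W g → ∫ (map (map₂ f) W) g ≡ ∫ W (g ∘ f)
∫-map f []            g = refl
∫-map f ((w , L) ∷ W) g = cong (λ x → (w ℤ.* g (f L)) + x) (∫-map f W g)

∫-filter : ∀ w (T : Subset n) D →
  weightAbove (map (w ,_) D) T ≡ w ℤ.* (+ length (filter (T ⊆?_) D))
∫-filter w T []      = sym (ℤₚ.*-zeroʳ w)
∫-filter w T (L ∷ D) rewrite ∫-filter w T D with does (T ⊆? L)
... | true  = one-more w (+ length (filter (T ⊆?_) D))
  where
  one-more : ∀ w c → w ℤ.* 1ℤ + w ℤ.* c ≡ w ℤ.* (1ℤ + c)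
  one-more = solve-∀
... | false = none-more w (+ length (filter (T ⊆?_) D))
  where
  none-more : ∀ w c → w ℤ.* 0ℤ + w ℤ.* c ≡ w ℤ.* c
  none-more = solve-∀

-- Sums over one-point enlargements

-- addSum S g is Σ_{x ∉ S} g (S ∪ {x}).
addSum : Subset n → (Subset n → ℤ) → ℤ
addSum []            g = 0ℤ
addSum (inside  ∷ S) g = addSum S (g ∘ (inside ∷_))
addSum (outside ∷ S) g = g (inside ∷ S) + addSum S (g ∘ (outside ∷_))

addSum-zero : ∀ (S : Subset n) g →
  (∀ S′ → ∣ S′ ∣ ≡ suc ∣ S ∣ → g S′ ≡ 0ℤ) → addSum S g ≡ 0ℤ
addSum-zero []            g z = refl
addSum-zero (inside  ∷ S) g z = addSum-zero S _ (λ S′ eq → z _ (cong suc eq))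
addSum-zero (outside ∷ S) g z =
  cong₂ _+_ (z _ refl) (addSum-zero S _ (λ S′ eq → z _ eq))

-- `m` is kept apart from `n` because the recursion shortens `S` while the members of `W` keep their
-- length.
addSum-∫ : ∀ (W : WeightedFamily n) {m} (S : Subset m) (G : Subset m → Subset n → ℤ) →
  addSum S (λ S′ → ∫ W (G S′)) ≡ ∫ W (λ L → addSum S (λ S′ → G S′ L))
addSum-∫ W []            G = sym (∫-0 W)
addSum-∫ W (inside  ∷ S) G = addSum-∫ W S _
addSum-∫ W (outside ∷ S) G =
  trans (cong (λ x → ∫ W (G (inside ∷ S)) + x) (addSum-∫ W S _)) (sym (∫-+ W _ _))

-- If `S ⊆ L`, the points that can be added are those of `L` outside `S`; otherwise no enlargement
-- of `S` fits into `L` and both sides vanish.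
addSum-𝟙 : ∀ (S L : Subset n) →
  addSum S (λ S′ → 𝟙[ S′ ⊆ L ]) ≡ (+ ∣ L ∣ - + ∣ S ∣) ℤ.* 𝟙[ S ⊆ L ]
addSum-𝟙 []            []            = refl
addSum-𝟙 (inside  ∷ S) (outside ∷ L) =
  trans (addSum-zero S _ (λ _ _ → refl)) (sym (ℤₚ.*-zeroʳ (+ ∣ L ∣ - + suc ∣ S ∣)))
addSum-𝟙 (inside  ∷ S) (inside  ∷ L) rewrite addSum-𝟙 S L =
  shift (+ ∣ L ∣) (+ ∣ S ∣) 𝟙[ S ⊆ L ]
  where
  shift : ∀ l s i → (l - s) ℤ.* i ≡ ((1ℤ + l) - (1ℤ + s)) ℤ.* i
  shift = solve-∀
addSum-𝟙 (outside ∷ S) (outside ∷ L) = trans (ℤₚ.+-identityˡ _) (addSum-𝟙 S L)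
addSum-𝟙 (outside ∷ S) (inside  ∷ L) rewrite addSum-𝟙 S L =
  one-more (+ ∣ L ∣) (+ ∣ S ∣) 𝟙[ S ⊆ L ]
  where
  one-more : ∀ l s i → i + (l - s) ℤ.* i ≡ ((1ℤ + l) - s) ℤ.* i
  one-more = solve-∀

-- After exchanging the two sums, each `L` above `S` is counted once per point of `L` outside `S`;
-- uniformity makes this number the same for all `L`.
addSum-weightAbove : ∀ {W : WeightedFamily n} → Uniform k W → ∀ S →
  addSum S (weightAbove W) ≡ (+ k - + ∣ S ∣) ℤ.* weightAbove W S
addSum-weightAbove {k = k} {W = W} uniform S = begin
  addSum S (weightAbove W)
    ≡⟨ addSum-∫ W S 𝟙[_⊆_] ⟩
  ∫ W (λ L → addSum S (λ S′ → 𝟙[ S′ ⊆ L ]))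
    ≡⟨ ∫-cong (All.map (λ { {_ , L} refl → addSum-𝟙 S L }) uniform) ⟩
  ∫ W (λ L → (+ k - + ∣ S ∣) ℤ.* 𝟙[ S ⊆ L ])
    ≡⟨ ∫-* W (+ k - + ∣ S ∣) _ ⟩
  (+ k - + ∣ S ∣) ℤ.* weightAbove W S ∎
  where open ≡-Reasoning

-- Alternating sums over subsets

-- altSum K g is Σ_{S ⊆ K} (−1)^|S| g S.
altSum : Subset n → (Subset n → ℤ) → ℤ
altSum []            g = g []
altSum (inside  ∷ K) g = altSum K (g ∘ (outside ∷_)) + -1ℤ ℤ.* altSum K (g ∘ (inside ∷_))
altSum (outside ∷ K) g = altSum K (g ∘ (outside ∷_))

-- Proper subsets of `K` are smaller than `K`, so only the term of `K` itself survives.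
altSum-top : ∀ (K : Subset n) g → (∀ S → ∣ S ∣ < ∣ K ∣ → g S ≡ 0ℤ) →
  altSum K g ≡ -1ℤ ℤ.^ ∣ K ∣ ℤ.* g K
altSum-top []            g z = sym (ℤₚ.*-identityˡ (g []))
altSum-top (outside ∷ K) g z = altSum-top K _ (λ S → z (outside ∷ S))
altSum-top (inside  ∷ K) g z
  rewrite altSum-top K (g ∘ (outside ∷_)) (λ S lt → z _ (ℕₚ.m<n⇒m<1+n lt))
        | altSum-top K (g ∘ (inside ∷_)) (λ S lt → z _ (s≤s lt))
        | z (outside ∷ K) ℕₚ.≤-refl
  = collect (-1ℤ ℤ.^ ∣ K ∣) (g (inside ∷ K))
  where
  collect : ∀ s x → s ℤ.* 0ℤ + -1ℤ ℤ.* (s ℤ.* x) ≡ -1ℤ ℤ.* s ℤ.* x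
  collect = solve-∀

altSum-0 : ∀ (K : Subset n) → altSum K (λ _ → 0ℤ) ≡ 0ℤ
altSum-0 K = trans (altSum-top K _ (λ _ _ → refl)) (ℤₚ.*-zeroʳ (-1ℤ ℤ.^ ∣ K ∣))

altSum-∫ : ∀ (W : WeightedFamily n) {m} (K : Subset m) (G : Subset m → Subset n → ℤ) →
  altSum K (λ S → ∫ W (G S)) ≡ ∫ W (λ L → altSum K (λ S → G S L))
altSum-∫ W []            G = refl
altSum-∫ W (outside ∷ K) G = altSum-∫ W K _
altSum-∫ W (inside  ∷ K) G = trans
  (cong₂ (λ x y → x + -1ℤ ℤ.* y) (altSum-∫ W K _) (altSum-∫ W K _))
  (sym (trans (∫-+ W _ _) (cong (λ x → ∫ W _ + x) (∫-* W -1ℤ _))))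

-- Only subsets of `K ∩ L` contribute. A common point pairs those with it and those without it, with
-- opposite signs; if there is none, the empty set alone remains, and disjointness means `L ⊆ ∁ K`.
altSum-𝟙 : ∀ (K L : Subset n) → altSum K (λ S → 𝟙[ S ⊆ L ]) ≡ 𝟙[ L ⊆ ∁ K ]
altSum-𝟙 []            []            = refl
altSum-𝟙 (outside ∷ K) (outside ∷ L) = altSum-𝟙 K L
altSum-𝟙 (outside ∷ K) (inside  ∷ L) = altSum-𝟙 K L
altSum-𝟙 (inside  ∷ K) (outside ∷ L)
  rewrite altSum-𝟙 K L | altSum-0 K = ℤₚ.+-identityʳ _
altSum-𝟙 (inside  ∷ K) (inside  ∷ L) = cancel (altSum K (λ S → 𝟙[ S ⊆ L ]))
  where
  cancel : ∀ x → x + -1ℤ ℤ.* x ≡ 0ℤ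
  cancel = solve-∀

⊆∧∣∣≡⇒≡ : ∀ {p q : Subset n} → p ⊆ q → ∣ p ∣ ≡ ∣ q ∣ → p ≡ q
⊆∧∣∣≡⇒≡ {p = []}          {[]}          _   _  = refl
⊆∧∣∣≡⇒≡ {p = outside ∷ p} {outside ∷ q} p⊆q eq =
  cong (outside ∷_) (⊆∧∣∣≡⇒≡ (drop-∷-⊆ p⊆q) eq)
⊆∧∣∣≡⇒≡ {p = outside ∷ p} {inside  ∷ q} p⊆q eq =
  contradiction (p⊆q⇒∣p∣≤∣q∣ (drop-∷-⊆ p⊆q)) (ℕₚ.<⇒≱ (ℕₚ.≤-reflexive (sym eq)))
⊆∧∣∣≡⇒≡ {p = inside  ∷ p} {outside ∷ q} p⊆q eq with () ← p⊆q here
⊆∧∣∣≡⇒≡ {p = inside  ∷ p} {inside  ∷ q} p⊆q eq =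
  cong (inside ∷_) (⊆∧∣∣≡⇒≡ (drop-∷-⊆ p⊆q) (ℕₚ.suc-injective eq))

-- Between sets of equal size inclusion is equality. This trades k-sets above `∁ K` for k-sets
-- inside `∁ K`.
𝟙-sym : ∀ (p q : Subset n) → ∣ p ∣ ≡ ∣ q ∣ → 𝟙[ p ⊆ q ] ≡ 𝟙[ q ⊆ p ]
𝟙-sym p q eq = cong (if_then 1ℤ else 0ℤ) (does-⇔
  (mk⇔ {A = p ⊆ q} {B = q ⊆ p}
    (λ p⊆q → ⊆-reflexive (sym (⊆∧∣∣≡⇒≡ p⊆q eq)))
    (λ q⊆p → ⊆-reflexive (sym (⊆∧∣∣≡⇒≡ q⊆p (sym eq)))))
  (p ⊆? q) (q ⊆? p))

-- Vanishing weights and complements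

module _ {W : WeightedFamily n} (uniform : Uniform k W)
         (null : ∀ T → suc ∣ T ∣ ≡ k → weightAbove W T ≡ 0ℤ) where

  -- With `m` as the gap k - 1 - |S|, the descent in |S| is induction on `m`: enlargements have a
  -- smaller gap, so their sum is 0, and the positive factor k - |S| cancels.
  weightAbove-small : ∀ m S → suc m ℕ.+ ∣ S ∣ ≡ k → weightAbove W S ≡ 0ℤ
  weightAbove-small zero    S eq   = null S eq
  weightAbove-small (suc m) S refl = ℤₚ.*-cancelˡ-≡ (+ suc (suc m)) _ _ (begin
    + suc (suc m) ℤ.* weightAbove W S
      ≡⟨ cong (ℤ._* weightAbove W S) (add-sub (+ suc (suc m)) (+ ∣ S ∣)) ⟩
    (+ k - + ∣ S ∣) ℤ.* weightAbove W S
      ≡⟨ addSum-weightAbove uniform S ⟨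
    addSum S (weightAbove W)
      ≡⟨ addSum-zero S _ (λ S′ eq → weightAbove-small m S′
           (trans (cong (suc m ℕ.+_) eq) (ℕₚ.+-suc (suc m) ∣ S ∣))) ⟩
    0ℤ
      ≡⟨ ℤₚ.*-zeroʳ (+ suc (suc m)) ⟨
    + suc (suc m) ℤ.* 0ℤ ∎)
    where
    open ≡-Reasoning
    add-sub : ∀ m s → m ≡ (m + s) - s
    add-sub = solve-∀

  -- Both sides evaluate `altSum K (weightAbove W)`: termwise over the members of `W`, and by the
  -- vanishing below size k.
  weightAbove-∁ : ∀ K → ∣ K ∣ ≡ k → ∣ ∁ K ∣ ≡ k →
    weightAbove W (∁ K) ≡ -1ℤ ℤ.^ k ℤ.* weightAbove W K
  weightAbove-∁ K refl ∣∁K∣≡k = begin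
    ∫ W (𝟙[ ∁ K ⊆_])
      ≡⟨ ∫-cong (All.map (λ { {_ , L} ∣L∣≡k → 𝟙-sym (∁ K) L (trans ∣∁K∣≡k (sym ∣L∣≡k)) }) uniform) ⟩
    ∫ W (𝟙[_⊆ ∁ K ])
      ≡⟨ ∫-cong (All.universal (λ (_ , L) → altSum-𝟙 K L) W) ⟨
    ∫ W (λ L → altSum K (λ S → 𝟙[ S ⊆ L ]))
      ≡⟨ altSum-∫ W K 𝟙[_⊆_] ⟨
    altSum K (weightAbove W)
      -- The gap for `S` is k - 1 - |S|; `lt` makes the truncated subtraction exact.
      ≡⟨ altSum-top K _ (λ S lt → weightAbove-small (∣ K ∣ ∸ suc ∣ S ∣) S
           (trans (sym (ℕₚ.+-suc _ ∣ S ∣)) (ℕₚ.m∸n+n≡m lt))) ⟩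
    -1ℤ ℤ.^ ∣ K ∣ ℤ.* weightAbove W K ∎
    where open ≡-Reasoning

-- The family of all k-subsets

-- All k-subsets, each of weight w.
layer : ℤ → ∀ n → ℕ → WeightedFamily n
layer w zero    zero    = (w , []) ∷ []
layer w zero    (suc k) = []
layer w (suc n) zero    = map (map₂ (outside ∷_)) (layer w n zero)
layer w (suc n) (suc k) =
  map (map₂ (inside ∷_)) (layer w n k) ++ map (map₂ (outside ∷_)) (layer w n (suc k))

layer-uniform : ∀ w n k → Uniform k (layer w n k)
layer-uniform w zero    zero    = refl ∷ []
layer-uniform w zero    (suc k) = []
layer-uniform w (suc n) zero    = map⁺ (layer-uniform w n zero)
layer-uniform w (suc n) (suc k) =
  ++⁺ (map⁺ (All.map (cong suc) (layer-uniform w n k))) (map⁺ (layer-uniform w n (suc k)))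

∫-layer-suc : ∀ w n k g → ∫ (layer w (suc n) (suc k)) g ≡
  ∫ (layer w n k) (g ∘ (inside ∷_)) + ∫ (layer w n (suc k)) (g ∘ (outside ∷_))
∫-layer-suc w n k g = trans
  (∫-++ (map (map₂ (inside ∷_)) (layer w n k)) _ g)
  (cong₂ _+_ (∫-map (inside ∷_) (layer w n k) g) (∫-map (outside ∷_) (layer w n (suc k)) g))

layer-below : ∀ w (T : Subset n) → k < ∣ T ∣ → weightAbove (layer w n k) T ≡ 0ℤ
layer-below {n} {k} w T k<∣T∣ = trans
  (∫-cong (All.map (λ { {_ , L} refl → cong (if_then 1ℤ else 0ℤ)
    (dec-false (T ⊆? L) (λ T⊆L → ℕₚ.<⇒≱ k<∣T∣ (p⊆q⇒∣p∣≤∣q∣ T⊆L))) })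
    (layer-uniform w n k)))
  (∫-0 (layer w n k))

layer-at : ∀ w (T : Subset n) → ∣ T ∣ ≡ k → weightAbove (layer w n k) T ≡ w
layer-at w []            refl = trans (ℤₚ.+-identityʳ _) (ℤₚ.*-identityʳ w)
-- Members omitting the first point cannot contain this set; their indicators reduce to 0, whence
-- `∫-0`.
layer-at {suc n} w (inside ∷ T)  refl
  rewrite ∫-layer-suc w n ∣ T ∣ (𝟙[ inside ∷ T ⊆_])
        | layer-at w T refl | ∫-0 (layer w n (suc ∣ T ∣)) = ℤₚ.+-identityʳ w
layer-at {suc n} {zero}  w (outside ∷ T) eq =
  trans (∫-map (outside ∷_) (layer w n zero) _) (layer-at w T eq)
layer-at {suc n} {suc k} w (outside ∷ T) eq
  rewrite ∫-layer-suc w n k (𝟙[ outside ∷ T ⊆_])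
        | layer-below w T (ℕₚ.≤-reflexive (sym eq)) | layer-at w T eq = ℤₚ.+-identityˡ w

-- Each point outside `T` completes it to one k-set. When the first point is outside `T`, `layer-at`
-- accounts for the completion by that point.
layer-above : ∀ w (T : Subset n) → suc ∣ T ∣ ≡ k →
  weightAbove (layer w n k) T ≡ w ℤ.* (+ n - + ∣ T ∣)
layer-above w [] refl = sym (ℤₚ.*-zeroʳ w)
layer-above {suc n} w (inside ∷ T) refl
  rewrite ∫-layer-suc w n (suc ∣ T ∣) (𝟙[ inside ∷ T ⊆_])
        | layer-above w T refl | ∫-0 (layer w n (suc (suc ∣ T ∣))) = shift w (+ n) (+ ∣ T ∣)
  where
  shift : ∀ w n t → w ℤ.* (n - t) + 0ℤ ≡ w ℤ.* ((1ℤ + n) - (1ℤ + t))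
  shift = solve-∀
layer-above {suc n} w (outside ∷ T) refl
  rewrite ∫-layer-suc w n ∣ T ∣ (𝟙[ outside ∷ T ⊆_])
        | layer-at w T refl | layer-above w T refl = one-more w (+ n) (+ ∣ T ∣)
  where
  one-more : ∀ w n t → w + w ℤ.* (n - t) ≡ w ℤ.* ((1ℤ + n) - t)
  one-more = solve-∀

-- Membership read off from counts

count : List (Subset n) → Subset n → ℕ
count D T = length (filter (T ⊆?_) D)

∈⇒count>0 : ∀ {D} {K : Subset n} → K ∈ D → 0 < count D K
∈⇒count>0 K∈D = filter-some (_ ⊆?_) (Any.map ⊆-reflexive K∈D)

-- A block that contains `K` and has the same size is `K`.
count>0⇒∈ : ∀ {D} {K : Subset n} → (∀ {L} → L ∈ D → ∣ L ∣ ≡ ∣ K ∣) → 0 < count D K → K ∈ D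
count>0⇒∈ {D = D} {K} size 0<c with filter (K ⊆?_) D in eq
... | L ∷ _ with L∈D , K⊆L ← ∈-filter⁻ (K ⊆?_) {xs = D} (subst (L ∈_) (sym eq) (Any.here refl)) =
  subst (_∈ D) (sym (⊆∧∣∣≡⇒≡ K⊆L (sym (size L∈D)))) L∈D

-- Application to the design

-1^odd : ∀ {m} → suc k ≡ 2 * m → -1ℤ ℤ.^ k ≡ -1ℤ
-1^odd {k} {m} eq = begin
  -1ℤ ℤ.^ k                      ≡⟨ double-neg (-1ℤ ℤ.^ k) ⟩
  -1ℤ ℤ.* (-1ℤ ℤ.^ suc k)        ≡⟨ cong (λ e → -1ℤ ℤ.* (-1ℤ ℤ.^ e)) eq ⟩
  -- The even power is the m-th power of (-1)², which evaluates to 1.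
  -1ℤ ℤ.* (-1ℤ ℤ.^ (2 * m))      ≡⟨ cong (-1ℤ ℤ.*_) (ℤₚ.^-*-assoc -1ℤ 2 m) ⟨
  -1ℤ ℤ.* (1ℤ ℤ.^ m)             ≡⟨ cong (-1ℤ ℤ.*_) (ℤₚ.^-zeroˡ m) ⟩
  -1ℤ                            ∎
  where
  open ≡-Reasoning
  double-neg : ∀ x → x ≡ -1ℤ ℤ.* (-1ℤ ℤ.* x)
  double-neg = solve-∀

-- Here k is `suc t` and λ is `m`. The equation k + 1 = 2m both balances the weights in `W-null` and
-- makes k odd.
module _ {t m : ℕ} (suc-k≡2m : suc (suc t) ≡ 2 * m) {D : List (Subset (2 * suc t))}
         (design : IsDesign t (2 * suc t) (suc t) m D) where

  open IsDesign design

  private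
    v : ℕ
    v = 2 * suc t

    W : WeightedFamily v
    W = map (+ 2 ,_) D ++ layer -1ℤ v (suc t)

    W-uniform : Uniform (suc t) W
    W-uniform = ++⁺ (map⁺ (All.tabulate blockSize)) (layer-uniform -1ℤ v (suc t))

    weightAbove-W : ∀ T → weightAbove W T ≡
      + 2 ℤ.* + count D T + weightAbove (layer -1ℤ v (suc t)) T
    weightAbove-W T = trans (∫-++ (map (+ 2 ,_) D) _ _)
      (cong (_+ weightAbove (layer -1ℤ v (suc t)) T) (∫-filter (+ 2) T D))

    -- `T` lies in m blocks, of total weight 2m = k + 1, and in 2k - (k - 1) = k + 1 k-sets of
    -- weight -1.
    W-null : ∀ T → suc ∣ T ∣ ≡ suc t → weightAbove W T ≡ 0ℤ
    W-null T suc∣T∣≡k = begin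
      weightAbove W T
        ≡⟨ weightAbove-W T ⟩
      + 2 ℤ.* + count D T + weightAbove (layer -1ℤ v (suc t)) T
        ≡⟨ cong₂ (λ c x → + 2 ℤ.* + c + x) (balanced T ∣T∣≡t) (layer-above -1ℤ T suc∣T∣≡k) ⟩
      + 2 ℤ.* + m + -1ℤ ℤ.* (+ v - + ∣ T ∣)
        ≡⟨ cong (λ s → + 2 ℤ.* + m + -1ℤ ℤ.* (+ v - + s)) ∣T∣≡t ⟩
      + 2 ℤ.* + m + -1ℤ ℤ.* (+ v - + t)
        ≡⟨ cong (_+ -1ℤ ℤ.* (+ v - + t)) (trans (sym (ℤₚ.pos-* 2 m)) (cong +_ (sym suc-k≡2m))) ⟩
      + suc (suc t) + -1ℤ ℤ.* (+ v - + t)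
        ≡⟨ cong (λ x → + suc (suc t) + -1ℤ ℤ.* (x - + t)) (ℤₚ.pos-* 2 (suc t)) ⟩
      + suc (suc t) + -1ℤ ℤ.* (+ 2 ℤ.* + suc t - + t)
        ≡⟨ balance (+ t) ⟩
      0ℤ ∎
      where
      open ≡-Reasoning
      ∣T∣≡t : ∣ T ∣ ≡ t
      ∣T∣≡t = ℕₚ.suc-injective suc∣T∣≡k
      balance : ∀ t → (+ 2 + t) + -1ℤ ℤ.* (+ 2 ℤ.* (1ℤ + t) - t) ≡ 0ℤ
      balance = solve-∀

    weightAbove-k : ∀ K → ∣ K ∣ ≡ suc t → weightAbove W K ≡ + 2 ℤ.* + count D K + -1ℤ
    weightAbove-k K eq =
      trans (weightAbove-W K) (cong (λ x → (+ 2 ℤ.* + count D K) + x) (layer-at -1ℤ K eq))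

  ∣∁∣≡k : ∀ (K : Subset (2 * suc t)) → ∣ K ∣ ≡ suc t → ∣ ∁ K ∣ ≡ suc t
  ∣∁∣≡k K eq = begin
    ∣ ∁ K ∣                              ≡⟨ ∣∁p∣≡n∸∣p∣ K ⟩
    2 * suc t ∸ ∣ K ∣                    ≡⟨ cong (2 * suc t ∸_) eq ⟩
    suc t ℕ.+ (suc t ℕ.+ 0) ∸ suc t      ≡⟨ ℕₚ.m+n∸m≡n (suc t) _ ⟩
    suc t ℕ.+ 0                          ≡⟨ ℕₚ.+-identityʳ (suc t) ⟩
    suc t                                ∎
    where open ≡-Reasoning

  -- The weights 2c - 1 and 2c′ - 1 of `K` and `∁ K` are opposite, so 2(c + c′) = 2.
  count-∁ : ∀ K → ∣ K ∣ ≡ suc t → count D K ℕ.+ count D (∁ K) ≡ 1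
  count-∁ K eq = ℤₚ.+-injective (ℤₚ.*-cancelˡ-≡ (+ 2) _ _ (begin
    + 2 ℤ.* (c + c′)
      ≡⟨ rearrange c c′ ⟩
    (+ 2 ℤ.* c′ + -1ℤ) + (+ 2 ℤ.* c + -1ℤ) + + 2
      ≡⟨ cong (λ x → x + (+ 2 ℤ.* c + -1ℤ) + + 2) antisymmetry ⟩
    -1ℤ ℤ.* (+ 2 ℤ.* c + -1ℤ) + (+ 2 ℤ.* c + -1ℤ) + + 2
      ≡⟨ cancel (+ 2 ℤ.* c + -1ℤ) ⟩
    + 2 ∎))
    where
    open ≡-Reasoning
    c c′ : ℤ
    c  = + count D K
    c′ = + count D (∁ K)
    rearrange : ∀ c c′ → + 2 ℤ.* (c + c′) ≡ (+ 2 ℤ.* c′ + -1ℤ) + (+ 2 ℤ.* c + -1ℤ) + + 2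
    rearrange = solve-∀
    cancel : ∀ x → -1ℤ ℤ.* x + x + + 2 ≡ + 2
    cancel = solve-∀
    antisymmetry : + 2 ℤ.* c′ + -1ℤ ≡ -1ℤ ℤ.* (+ 2 ℤ.* c + -1ℤ)
    antisymmetry = begin
      + 2 ℤ.* c′ + -1ℤ                      ≡⟨ weightAbove-k (∁ K) (∣∁∣≡k K eq) ⟨
      weightAbove W (∁ K)                   ≡⟨ weightAbove-∁ W-uniform W-null K eq (∣∁∣≡k K eq) ⟩
      -1ℤ ℤ.^ suc t ℤ.* weightAbove W K     ≡⟨ cong₂ ℤ._*_ (-1^odd {m = m} suc-k≡2m) (weightAbove-k K eq) ⟩
      -1ℤ ℤ.* (+ 2 ℤ.* c + -1ℤ)             ∎

  antiComplementary : AntiComplementary (2 * suc t) (suc t) D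
  antiComplementary K ∣K∣≡k = mk⇔ to from
    where
    to : K ∈ D → ∁ K ∉ D
    -- Two blocks would make the sum of the counts at least 2.
    to K∈D ∁K∈D = contradiction (count-∁ K ∣K∣≡k)
      (ℕₚ.>⇒≢ (ℕₚ.+-mono-≤ (∈⇒count>0 K∈D) (∈⇒count>0 ∁K∈D)))
    from : ∁ K ∉ D → K ∈ D
    -- Matching on `count-∁` rules out that both counts are zero, as it would then read 0 ≡ 1.
    from ∁K∉D with count D K in cK | count D (∁ K) in c∁K | count-∁ K ∣K∣≡k
    ... | suc _ | _     | _ =
      count>0⇒∈ (λ L∈D → trans (blockSize L∈D) (sym ∣K∣≡k)) (subst (0 <_) (sym cK) (s≤s z≤n))
    ... | zero  | suc _ | _ = contradiction
      (count>0⇒∈ (λ L∈D → trans (blockSize L∈D) (sym (∣∁∣≡k K ∣K∣≡k)))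
        (subst (0 <_) (sym c∁K) (s≤s z≤n)))
      ∁K∉D

k≡2^a∸1⇒1+k≡2^a : ∀ a → k ≡ 2 ^ a ∸ 1 → suc k ≡ 2 ^ a
k≡2^a∸1⇒1+k≡2^a a eq = trans (cong suc eq) (ℕₚ.m+[n∸m]≡n (ℕₚ.m^n>0 2 a))

corollary3 : (a : ℕ) → 1 ≤ a →
    (k : ℕ) → k ≡ 2 ^ a ∸ 1 →
    (D : List (Subset (2 * k))) →
    IsDesign (k ∸ 1) (2 * k) k (2 ^ (a ∸ 1)) D →
    AntiComplementary (2 * k) k D
-- k = 0 would make the even number 2 · 2^b equal to 1.
corollary3 (suc b) _ zero    eq D design =
  contradiction (sym (k≡2^a∸1⇒1+k≡2^a (suc b) eq)) (ℕₚ.even≢odd (2 ^ b) 0)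
-- With a = b + 1, the power 2^a unfolds to 2 · 2^b, so m is 2^b, the λ of the design.
corollary3 (suc b) _ (suc t) eq D design =
  antiComplementary (k≡2^a∸1⇒1+k≡2^a (suc b) eq) design
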